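{- No compact graph is $\omega$-saturated. Moreover, no open graph on a compact space is $\omega$-saturated.
   Context: All topological spaces are assumed to be Hausdorff. A graph is a pair $(V,E)$ where $E$ is a symmetric and reflexive binary relation on $V$ (every vertex has a loop). A graph on a topological space $X$ (i.e. with vertex set $X$) is called compact if its edge relation is a compact subset of $X^2$; it is called open if its edge relation with the diagonal removed, $\{(x,y)\in E: x\neq y\}$, is an open subset of $X^2$ without the diagonal. A graph $G$ is $\omega$-saturated if for all disjoint finite sets $A,B\subseteq G$ there exists $v\in G\setminus(A\cup B)$ adjacent to all elements of $A$ and to no element of $B$. -}

module Defs where

open import Level using (Level; suc; _⊔_)
open import Data.List using (List)
open import Data.List.Membership.Propositional using () renaming (_∈_ to _∈ˡ_; _∉_ to _∉ˡ_)
open import Data.List.Relation.Binary.Disjoint.Propositional using (Disjoint)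
open import Data.List.Relation.Unary.Any using (Any)
open import Data.Product using (_×_; _,_; ∃; ∃₂; uncurry)
open import Data.Unit.Polymorphic using (⊤; tt)
open import Relation.Binary using (Rel; Reflexive; Symmetric)
open import Relation.Binary.PropositionalEquality using (_≢_)
open import Relation.Nullary using (¬_)
open import Relation.Unary using (Pred; _∈_; _⊆_; _≐_; _∩_; ⋃; _⊥_; U; _⟨×⟩_)

private
  variable
    ℓ k : Level


-- Subsets are predicates, and predicates with the same elements need not be
-- propositionally equal; Open-resp-≐ makes openness depend on the elements
-- only. That ∅ is open is the case of Open-⋃ where I is empty. Families of open
-- sets, here and in IsCompact, are indexed by types at the level of X.
-- Classically this is no restriction, since each subset of X is determined by
-- a map X → Bool and the type of such maps is at that level.
record Topology (X : Set ℓ) : Set (suc (suc ℓ)) where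
  field
    Open        : Pred (Pred X ℓ) (suc ℓ)
    Open-resp-≐ : ∀ {V W} → V ≐ W → Open V → Open W
    Open-U      : Open (λ _ → ⊤)
    Open-∩      : ∀ {V W} → Open V → Open W → Open (V ∩ W)
    Open-⋃      : ∀ (I : Set ℓ) (V : I → Pred X ℓ) → (∀ i → Open (V i)) → Open (⋃ I V)

open Topology

Hausdorff : {X : Set ℓ} → Topology X → Set (suc ℓ)
Hausdorff 𝒯 = ∀ {x y} → x ≢ y →
  ∃₂ λ V W → Open 𝒯 V × Open 𝒯 W × x ∈ V × y ∈ W × V ⊥ W

IsCompact : {X : Set ℓ} → Topology X → Pred X k → Set (suc ℓ ⊔ k)
IsCompact {ℓ = ℓ} {X = X} 𝒯 K =
  ∀ (I : Set ℓ) (V : I → Pred X ℓ) → (∀ i → Open 𝒯 (V i)) → K ⊆ ⋃ I V →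
  ∃ λ (is : List I) → K ⊆ λ x → Any (λ i → x ∈ V i) is

CompactSpace : {X : Set ℓ} → Topology X → Set (suc ℓ)
CompactSpace 𝒯 = IsCompact 𝒯 U

-- Openness of A ⊆ S in the subspace topology of S; the inclusion A ⊆ S is part
-- of A ≐ S ∩ W.
IsOpenIn : {X : Set ℓ} → Topology X → Pred X ℓ → Pred X ℓ → Set (suc ℓ)
IsOpenIn 𝒯 S A = ∃ λ W → Open 𝒯 W × A ≐ S ∩ W

productTopology : {X Y : Set ℓ} → Topology X → Topology Y → Topology (X × Y)
productTopology 𝒮 𝒯 = record
  { Open = λ O → ∀ {x y} → (x , y) ∈ O →
      ∃₂ λ V W → Open 𝒮 V × Open 𝒯 W × x ∈ V × y ∈ W × (V ⟨×⟩ W) ⊆ O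
  ; Open-resp-≐ = λ (O⊆P , P⊆O) open-O p →
      let V , W , oV , oW , x∈V , y∈W , VW⊆O = open-O (P⊆O p)
      in  V , W , oV , oW , x∈V , y∈W , λ q → O⊆P (VW⊆O q)
  ; Open-U = λ _ → _ , _ , Open-U 𝒮 , Open-U 𝒯 , tt , tt , λ _ → tt
  ; Open-∩ = λ open-O open-P (o , p) →
      let V  , W  , oV  , oW  , x∈V  , y∈W  , VW⊆O = open-O o
          V′ , W′ , oV′ , oW′ , x∈V′ , y∈W′ , VW⊆P = open-P p
      in  V ∩ V′ , W ∩ W′ , Open-∩ 𝒮 oV oV′ , Open-∩ 𝒯 oW oW′
          , (x∈V , x∈V′) , (y∈W , y∈W′)
          , λ ((v , v′) , (w , w′)) → VW⊆O (v , w) , VW⊆P (v′ , w′)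
  ; Open-⋃ = λ I O open-O (i , o) →
      let V , W , oV , oW , x∈V , y∈W , VW⊆O = open-O i o
      in  V , W , oV , oW , x∈V , y∈W , λ q → i , VW⊆O q
  }

record Graph (X : Set ℓ) : Set (suc ℓ) where
  field
    Adj     : Rel X ℓ
    adjRefl : Reflexive Adj
    adjSym  : Symmetric Adj

  edges : Pred (X × X) ℓ
  edges = uncurry Adj

open Graph

offDiagonal : {X : Set ℓ} → Pred (X × X) ℓ
offDiagonal = uncurry _≢_

IsCompactGraph : {X : Set ℓ} → Topology X → Graph X → Set (suc ℓ)
IsCompactGraph 𝒯 G = IsCompact (productTopology 𝒯 𝒯) (edges G)

IsOpenGraph : {X : Set ℓ} → Topology X → Graph X → Set (suc ℓ)
IsOpenGraph 𝒯 G =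
  IsOpenIn (productTopology 𝒯 𝒯) offDiagonal (edges G ∩ offDiagonal)

-- Finite subsets are given by lists enumerating them.
ω-Saturated : {X : Set ℓ} → Graph X → Set ℓ
ω-Saturated {X = X} G = ∀ (A B : List X) → Disjoint A B →
  ∃ λ v → v ∉ˡ A × v ∉ˡ B ×
    (∀ {a} → a ∈ˡ A → Adj G v a) × (∀ {b} → b ∈ˡ B → ¬ Adj G v b)

{-# OPTIONS --safe #-}

-- If every vertex y has a vertex x such that all points of a neighbourhood of y
-- are non-adjacent to x, then by compactness finitely many such x form a set to
-- which no vertex is completely adjacent, against saturation. In a compact
-- graph any x not adjacent to y will do, because compact sets in Hausdorff
-- spaces are closed; a compact graph lives on a compact space because it
-- contains the diagonal. The case of open graphs is dual.
module Submission where

open import Defs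
open import Axiom.ExcludedMiddle using (ExcludedMiddle)
open import Data.List using (List; []; _∷_; map)
open import Data.List.Membership.Propositional using (find) renaming (_∈_ to _∈ˡ_)
open import Data.List.Relation.Unary.All as All using (All; []; _∷_)
open import Data.List.Relation.Unary.Any as Any using (Any; here)
open import Data.List.Relation.Unary.Any.Properties using (map⁺)
open import Data.Product using (_×_; _,_; ∃; ∃₂; proj₁; proj₂)
open import Data.Unit.Polymorphic using (⊤; tt)
open import Level using (Level)
open import Relation.Binary using (Rel)
open import Relation.Binary.PropositionalEquality using (_≢_; refl; sym)
open import Relation.Nullary using (¬_; yes; no)
open import Relation.Unary using (Pred; _∈_; _∉_; _⊥_; _∩_; _⟨×⟩_)

open Topology
open Graph

private
  variable
    ℓ k : Level
    X : Set ℓ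

Open-× : (𝒮 𝒯 : Topology X) {V W : Pred X _} → Open 𝒮 V → Open 𝒯 W →
  Open (productTopology 𝒮 𝒯) (V ⟨×⟩ W)
Open-× 𝒮 𝒯 oV oW (x∈V , y∈W) = _ , _ , oV , oW , x∈V , y∈W , λ q → q

Open-⋂ : (𝒯 : Topology {ℓ} X) {I : Set ℓ} {V : I → Pred X ℓ} →
  (∀ i → Open 𝒯 (V i)) → (is : List I) →
  ∃ λ W → Open 𝒯 W × (∀ {x} → (∀ i → x ∈ V i) → x ∈ W) ×
    (∀ {x} → x ∈ W → All (λ i → x ∈ V i) is)
Open-⋂ 𝒯 oV []       = _ , Open-U 𝒯 , (λ _ → tt) , λ _ → []
Open-⋂ 𝒯 oV (i ∷ is) =
  let W , oW , ⊆W , W⊆ = Open-⋂ 𝒯 oV is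
  in  _ , Open-∩ 𝒯 (oV i) oW , (λ f → f i , ⊆W f) , λ (v , w) → v ∷ W⊆ w

Separated : Topology {ℓ} X → (x y : X) → Set _
Separated 𝒯 x y = ∃₂ λ V W → Open 𝒯 V × Open 𝒯 W × x ∈ V × y ∈ W × V ⊥ W

-- Distinct pairs differ in some coordinate, and excluded middle decides whether it is the first.
-- Separating that coordinate and leaving the other free gives disjoint open cylinders.
Hausdorff-× : ExcludedMiddle ℓ → {X : Set ℓ} (𝒯 : Topology X) → Hausdorff 𝒯 →
  ∀ {p q} → p ≢ q → Separated (productTopology 𝒯 𝒯) p q
Hausdorff-× em 𝒯 haus {a , b} {c , d} p≢q with em
... | no a≢c =
  let V , W , oV , oW , a∈V , c∈W , V⊥W = haus a≢c
  in  _ , _ , Open-× 𝒯 𝒯 oV (Open-U 𝒯) , Open-× 𝒯 𝒯 oW (Open-U 𝒯)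
      , (a∈V , tt) , (c∈W , tt) , λ ((v , _) , (w , _)) → V⊥W (v , w)
... | yes refl =
  let V , W , oV , oW , b∈V , d∈W , V⊥W = haus λ { refl → p≢q refl }
  in  _ , _ , Open-× 𝒯 𝒯 (Open-U 𝒯) oV , Open-× 𝒯 𝒯 (Open-U 𝒯) oW
      , (tt , b∈V) , (tt , d∈W) , λ ((_ , v) , (_ , w)) → V⊥W (v , w)

-- Each `z` in `K` is separated from `x` by some `V` around `z` and `W` around `x`. Finitely many
-- `V` cover `K`, and the intersection of their partners `W` is a neighbourhood of `x` that misses
-- all of them.
compact-closed : (𝒯 : Topology {ℓ} X) → Hausdorff 𝒯 → {K : Pred X ℓ} →
  IsCompact 𝒯 K → ∀ {x} → x ∉ K → ∃ λ W → Open 𝒯 W × x ∈ W × W ⊥ K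
compact-closed {X = X} 𝒯 haus {K} compact {x} x∉K =
  let is , covered     = compact (∃ K) V oV λ z∈K → (_ , z∈K) , z∈V (_ , z∈K)
      N , oN , ⊆N , N⊆ = Open-⋂ 𝒯 oW is
  in  N , oN , ⊆N x∈W , λ (n , z∈K) →
        All.lookupWith (λ {i} w v → V⊥W i (v , w)) (N⊆ n) (covered z∈K)
  where
  separated : ((z , _) : ∃ K) → Separated 𝒯 z x
  separated (z , z∈K) = haus λ { refl → x∉K z∈K }

  V W : ∃ K → Pred X _
  V i = proj₁ (separated i)
  W i = proj₁ (proj₂ (separated i))

  oV : ∀ i → Open 𝒯 (V i)
  oV i = let _ , _ , o , _ = separated i in o

  oW : ∀ i → Open 𝒯 (W i)
  oW i = let _ , _ , _ , o , _ = separated i in o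

  z∈V : ∀ i → proj₁ i ∈ V i
  z∈V i = let _ , _ , _ , _ , z , _ = separated i in z

  x∈W : ∀ i → x ∈ W i
  x∈W i = let _ , _ , _ , _ , _ , w , _ = separated i in w

  V⊥W : ∀ i → V i ⊥ W i
  V⊥W i = let _ , _ , _ , _ , _ , _ , d = separated i in d

-- A cover of the space pulls back along the first projection to a cover of the edges; the loop at a
-- vertex shows that the finite subcover still reaches that vertex.
compactGraph⇒compactSpace : (𝒯 : Topology X) (G : Graph X) →
  IsCompactGraph 𝒯 G → CompactSpace 𝒯
compactGraph⇒compactSpace 𝒯 G compact I V oV cover =
  let is , covered = compact I (λ i → V i ⟨×⟩ (λ _ → ⊤))
        (λ i → Open-× 𝒯 𝒯 (oV i) (Open-U 𝒯))
        (λ _ → let i , v = cover _ in i , v , tt)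
  in  is , λ _ → Any.map proj₁ (covered (adjRefl G))

-- Used with `R` as non-adjacency for compact graphs and as adjacency for open ones. The cover is
-- indexed by the points `y` themselves, so a finite subcover lists the `y` whose witnesses `x`
-- suffice.
finite-witnesses : (𝒯 : Topology {ℓ} X) → CompactSpace 𝒯 → {R : Rel X k} →
  (∀ y → ∃₂ λ x V → Open 𝒯 V × y ∈ V × (∀ {v} → v ∈ V → R v x)) →
  ∃ λ xs → ∀ v → ∃ λ x → x ∈ˡ xs × R v x
finite-witnesses {X = X} 𝒯 compact {R} local =
  let ys , covered = compact X (λ y → proj₁ (proj₂ (local y)))
        (λ y → let _ , _ , o , _ = local y in o)
        (λ {y} _ → y , (let _ , _ , _ , m , _ = local y in m))
  in  map (λ y → proj₁ (local y)) ys , λ v →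
        find (map⁺ (Any.map (λ {y} → let _ , _ , _ , _ , r = local y in r) (covered _)))

corollary2p7 : ∀ {ℓ} → ExcludedMiddle ℓ →
    {X : Set ℓ} (𝒯 : Topology X) → Hausdorff 𝒯 → (G : Graph X) →
    (IsCompactGraph 𝒯 G → ¬ ω-Saturated G) ×
    (CompactSpace 𝒯 → IsOpenGraph 𝒯 G → ¬ ω-Saturated G)
corollary2p7 em 𝒯 haus G = compactCase , openCase
  where
  compactCase : IsCompactGraph 𝒯 G → ¬ ω-Saturated G
  compactCase compact saturated =
    let xs , witness = finite-witnesses 𝒯 (compactGraph⇒compactSpace 𝒯 G compact)
          {R = λ v x → ¬ Adj G v x} locally-nonadjacent
        v , _ , _ , adjacent , _ = saturated xs [] λ ()
        x , x∈xs , ¬vx = witness v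
    in  ¬vx (adjacent x∈xs)
    where
    locally-nonadjacent : ∀ y → ∃₂ λ x V →
      Open 𝒯 V × y ∈ V × (∀ {v} → v ∈ V → ¬ Adj G v x)
    locally-nonadjacent y =
      let x , _ , _ , _ , nonadjacent = saturated [] (y ∷ []) λ ()
          N , oN , yx∈N , N⊥E = compact-closed (productTopology 𝒯 𝒯)
            (Hausdorff-× em 𝒯 haus) compact
            λ yx → nonadjacent (here refl) (adjSym G yx)
          -- In a rectangle around `(y , x)` that misses the edges, the slice with second coordinate
          -- `x` shows that no point of `V` is adjacent to `x`.
          V , _ , oV , _ , y∈V , x∈W , VW⊆N = oN yx∈N
      in  x , V , oV , y∈V , λ v∈V vx → N⊥E (VW⊆N (v∈V , x∈W) , vx)

  openCase : CompactSpace 𝒯 → IsOpenGraph 𝒯 G → ¬ ω-Saturated G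
  openCase compact (O , oO , E⊆O , O⊆E) saturated =
    let xs , witness = finite-witnesses 𝒯 compact {R = Adj G} locally-adjacent
        v , _ , _ , _ , nonadjacent = saturated [] xs λ ()
        x , x∈xs , vx = witness v
    in  nonadjacent x∈xs vx
    where
    locally-adjacent : ∀ y → ∃₂ λ x V →
      Open 𝒯 V × y ∈ V × (∀ {v} → v ∈ V → Adj G v x)
    locally-adjacent y =
      -- Saturation puts `x` outside `y ∷ []`, so the edge from `y` to `x` is not a loop and lies in
      -- the open set `O`.
      let x , x∉A , _ , adjacent , _ = saturated (y ∷ []) [] λ ()
          y≢x = λ y≡x → x∉A (here (sym y≡x))
          V , _ , oV , _ , y∈V , x∈W , VW⊆O =
            oO (proj₂ (E⊆O (adjSym G (adjacent (here refl)) , y≢x)))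
          -- `O` agrees with the edges only off the diagonal, so `V` is shrunk by a neighbourhood of
          -- `y` that excludes `x`.
          V′ , _ , oV′ , _ , y∈V′ , x∈W′ , V′⊥W′ = haus y≢x
      in  x , V ∩ V′ , Open-∩ 𝒯 oV oV′ , (y∈V , y∈V′) , λ (v∈V , v∈V′) →
            proj₁ (O⊆E ((λ { refl → V′⊥W′ (v∈V′ , x∈W′) }) , VW⊆O (v∈V , x∈W)))
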